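{- A graph $G$ is balanceable if and only if $G$ has both a partition $V(G)=X\cup Y$ and a set of vertices $W\subseteq V(G)$ such that $e(X,Y),\,e(G[W])\in\{\lfloor\frac12 e(G)\rfloor,\lceil\frac12 e(G)\rceil\}$.
   Context: Graphs are finite and simple; $e(G)=|E(G)|$; for a partition $V(G)=X\cup Y$ (disjoint parts, possibly empty), $e(X,Y)$ is the number of edges with one end in $X$ and the other in $Y$; $G[W]$ is the subgraph induced by $W$. A $2$-coloring $E(K_n)=E(R)\cup E(B)$ is a partition of the edges of $K_n$ into red edges (forming $R$) and blue edges (forming $B$). An $(r,b)$-colored copy of $G$ (with $r+b=e(G)$) is a (not necessarily induced) subgraph of $K_n$ isomorphic to $G$ with exactly $r$ red and $b$ blue edges. A balanced copy of $G$ is an $(e(G)/2,e(G)/2)$-colored copy if $e(G)$ is even, and a copy that is either $(\lceil e(G)/2\rceil,\lfloor e(G)/2\rfloor)$-colored or $(\lfloor e(G)/2\rfloor,\lceil e(G)/2\rceil)$-colored if $e(G)$ is odd. ${\rm bal}(n,G)$ is the minimum non-negative integer $s$ such that every $2$-coloring $E(K_n)=E(R)\cup E(B)$ with $\min\{e(R),e(B)\}>s$ contains a balanced copy of $G$. The graph $G$ is balanceable if for every sufficiently large $n$ such an integer exists non-vacuously, that is, ${\rm bal}(n,G)<\lfloor\frac12\binom n2\rfloor$ (so that there are colorings with $\min\{e(R),e(B)\}>{\rm bal}(n,G)$). -}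

module Defs where

open import Level using (0ℓ)
open import Data.Nat using (ℕ; _≤_; _<_; _⊓_; ⌊_/2⌋; ⌈_/2⌉)
open import Data.Nat.Combinatorics using (_C_)
open import Data.Fin as Fin using (Fin)
open import Data.Fin.Subset using (Subset; _∈_; _∪_; _∩_; ⊤; ⊥)
open import Data.Fin.Subset.Properties using (_∈?_)
open import Data.List using (List; length; filter; map; allFin; cartesianProduct)
open import Data.Product using (Σ; ∃-syntax; _×_; _,_)
open import Data.Sum using (_⊎_)
open import Function.Bundles using (_↣_; module Injection)
open import Relation.Binary using (Rel; Decidable; Symmetric; Irreflexive)
open import Relation.Binary.PropositionalEquality using (_≡_; _≢_)
open import Relation.Nullary using (¬_)
open import Relation.Nullary.Decidable using (_×-dec_; _⊎-dec_)

record Graph (n : ℕ) : Set₁ where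
  field
    Adj       : Rel (Fin n) 0ℓ
    adj?      : Decidable Adj
    symmetric : Symmetric Adj
    loopless  : Irreflexive _≡_ Adj

open Graph public

-- Each edge {i , j} is listed exactly once, as the pair with i < j.
edges : ∀ {n} → Graph n → List (Fin n × Fin n)
edges {n} G =
  filter (λ (i , j) → (i Fin.<? j) ×-dec adj? G i j)
         (cartesianProduct (allFin n) (allFin n))

e : ∀ {n} → Graph n → ℕ
e G = length (edges G)

IsPartition : ∀ {n} → Subset n → Subset n → Set
IsPartition X Y = X ∪ Y ≡ ⊤ × X ∩ Y ≡ ⊥

eBetween : ∀ {n} → Graph n → Subset n → Subset n → ℕ
eBetween G X Y =
  length (filter (λ (i , j) → ((i ∈? X) ×-dec (j ∈? Y)) ⊎-dec
                              ((i ∈? Y) ×-dec (j ∈? X)))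
                 (edges G))

-- The number of edges of the induced subgraph G[W].
eInduced : ∀ {n} → Graph n → Subset n → ℕ
eInduced G W =
  length (filter (λ (i , j) → (i ∈? W) ×-dec (j ∈? W)) (edges G))

-- E(K_n) is the disjoint union of E(R) and E(B).
record Coloring (n : ℕ) : Set₁ where
  field
    R B      : Graph n
    cover    : ∀ i j → i ≢ j → Adj R i j ⊎ Adj B i j
    disjoint : ∀ i j → ¬ (Adj R i j × Adj B i j)

open Coloring public

-- A copy of G in K_n is given by an injection φ of the vertices; it is the
-- subgraph with vertex set the image of φ and the edges listed here.  By
-- injectivity they are pairwise distinct, but a pair (φ i , φ j) need not be
-- in increasing order.
copyEdges : ∀ {m n} → Graph m → Fin m ↣ Fin n → List (Fin n × Fin n)
copyEdges G φ = map (λ (i , j) → (to i , to j)) (edges G)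
  where open Injection φ using (to)

countIn : ∀ {n} → Graph n → List (Fin n × Fin n) → ℕ
countIn H es = length (filter (λ (i , j) → adj? H i j) es)

ColoredCopy : ∀ {m n} → Graph m → Coloring n → ℕ → ℕ → Set
ColoredCopy {m} {n} G c r b =
  Σ (Fin m ↣ Fin n) λ φ →
    countIn (R c) (copyEdges G φ) ≡ r × countIn (B c) (copyEdges G φ) ≡ b

-- For e G even the two alternatives coincide with (e G / 2 , e G / 2).
BalancedCopy : ∀ {m n} → Graph m → Coloring n → Set
BalancedCopy G c =
  ColoredCopy G c ⌈ e G /2⌉ ⌊ e G /2⌋ ⊎ ColoredCopy G c ⌊ e G /2⌋ ⌈ e G /2⌉

Forces : ∀ {m} → ℕ → Graph m → ℕ → Set₁
Forces n G s = (c : Coloring n) → s < e (R c) ⊓ e (B c) → BalancedCopy G c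

-- bal(n,G) = s
IsBal : ∀ {m} → ℕ → Graph m → ℕ → Set₁
IsBal n G s = Forces n G s × (∀ t → Forces n G t → s ≤ t)

Balanceable : ∀ {m} → Graph m → Set₁
Balanceable G =
  ∃[ N ] ∀ n → N ≤ n → ∃[ s ] (IsBal n G s × s < ⌊ n C 2 /2⌋)

IsHalf : ℕ → ℕ → Set
IsHalf k x = x ≡ ⌊ k /2⌋ ⊎ x ≡ ⌈ k /2⌉

{-# OPTIONS --safe #-}

-- Necessity: for infinitely many n some clique K_a in K_n has exactly half of
-- the edges of K_n (a Pell equation), and so has some complete bipartite K_{a,b}
-- with a + b = n (n a square).  Colour it red and the rest blue: a balanced copy
-- of G pulls the first a vertices back to W, respectively X.
--
-- Sufficiency: let n be large and let each colour have half of the edges.  By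
-- Kővári–Sós–Turán each colour k contains a large complete bipartite graph, and
-- Ramsey's theorem in its two parts gives a large clique of colour k or a clique
-- of the other colour completely joined to a monochromatic clique in colour k.
-- If the first alternative holds for both colours, the bipartite Ramsey theorem
-- between a red and a blue clique gives the second.  In that pattern either the
-- partition X, Y or the set W yields a balanced copy.
module Submission where

open import Data.Bool using (Bool; true; false; not; if_then_else_)
open import Data.Bool.Properties using (¬-not) renaming (_≟_ to _≟ᵇ_)
open import Data.Fin as Fin using (Fin; zero; suc; toℕ)
open import Data.Fin.Properties using (any?; all?; inject≤-injective; toℕ<n)
open import Data.Fin.Subset as Subset using (Subset; ∁)
open import Data.Fin.Subset.Properties as Subset
  using (anySubset?; p∪∁p≡⊤; ∩-inverseʳ; x∉p⇒x∈∁p; x∈∁p⇒x∉p)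
open import Data.List
  using (List; []; _∷_; length; filter; map; _++_; cartesianProduct; take; lookup; allFin; tabulate)
open import Data.List.Membership.Propositional using (_∈_)
open import Data.List.Membership.Propositional.Properties using (∈-lookup)
open import Data.List.Properties
  using (filter-accept; filter-reject; filter-++; length-++; length-filter; length-take; length-tabulate;
         map-cong; map-tabulate)
open import Data.List.Relation.Binary.Sublist.Propositional
  using (_⊆_; []; _∷_; _∷ʳ_; ⊆-refl; ⊆-trans; minimum) renaming (lookup to Sublist-lookup)
open import Data.List.Relation.Binary.Sublist.Propositional.Properties using (filter-⊆; take-⊆; All-resp-⊆)
open import Data.List.Relation.Unary.All as All using (All; []; _∷_)
import Data.List.Relation.Unary.All.Properties as All
open import Data.List.Relation.Unary.AllPairs using (AllPairs; []; _∷_)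
open import Data.List.Relation.Unary.Any.Properties using (lookup-index)
open import Data.List.Relation.Unary.Unique.Propositional using (Unique)
open import Data.List.Relation.Unary.Unique.Propositional.Properties using (allFin⁺)
open import Data.Nat
open import Data.Nat.Combinatorics using (_C_; nC1≡n; nCk+nC[k+1]≡[n+1]C[k+1])
open import Data.Nat.ListAction using (sum)
open import Data.Nat.Properties
open import Data.Nat.Tactic.RingSolver using (solve-∀)
open import Data.Product using (Σ; ∃; ∃-syntax; _×_; _,_; proj₁; proj₂; swap)
open import Data.Sum as Sum using (_⊎_; inj₁; inj₂)
open import Data.Unit using (tt)
open import Data.Vec as Vec using (Vec; []; _∷_)
open import Data.Vec.Properties using (lookup∘tabulate; lookup⇒[]=; []=⇒lookup)
open import Function using (_∘_; id; case_of_)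
open import Function.Bundles using (_⇔_; mk⇔; module Equivalence; _↣_; mk↣; module Injection)
open import Level using (Level; 0ℓ)
import Relation.Binary as B
open import Relation.Binary.PropositionalEquality
open import Relation.Nullary
open import Relation.Nullary.Decidable
  using (toSum; _×-dec_; _⊎-dec_; _→-dec_; map′; decidable-stable; dec-true; dec-false)
open import Relation.Unary using (Pred; Decidable)
open import Defs

open import Algebra.Properties.CommutativeSemigroup +-commutativeSemigroup using (x∙yz≈y∙xz)

private variable
  a b p q : Level
  A : Set a
  A′ : Set b

-- Counting

count : {P : Pred A p} → Decidable P → List A → ℕ
count P? xs = length (filter P? xs)

module _ {P : Pred A p} (P? : Decidable P) where

  count-accept : ∀ {x} xs → P x → count P? (x ∷ xs) ≡ suc (count P? xs)
  count-accept xs px = cong length (filter-accept P? px)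

  count-reject : ∀ {x} xs → ¬ P x → count P? (x ∷ xs) ≡ count P? xs
  count-reject xs ¬px = cong length (filter-reject P? ¬px)

  count-++ : ∀ xs ys → count P? (xs ++ ys) ≡ count P? xs + count P? ys
  count-++ xs ys = trans (cong length (filter-++ P? xs ys)) (length-++ (filter P? xs))

  count-map : (f : A′ → A) (xs : List A′) → count P? (map f xs) ≡ count (P? ∘ f) xs
  count-map f [] = refl
  count-map f (x ∷ xs) with P? (f x)
  ... | yes _ = cong suc (count-map f xs)
  ... | no _ = count-map f xs

module _ {P : Pred A p} {Q : Pred A q} (P? : Decidable P) (Q? : Decidable Q) where

  count-cong : ∀ {xs} → All (λ x → P x ⇔ Q x) xs → count P? xs ≡ count Q? xs
  count-cong [] = refl
  count-cong {x ∷ xs} (e ∷ es) with P? x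
  ... | yes px = trans (cong suc (count-cong es)) (sym (count-accept Q? xs (Equivalence.to e px)))
  ... | no ¬px = trans (count-cong es) (sym (count-reject Q? xs (¬px ∘ Equivalence.from e)))

  count-split : ∀ {xs} → All (λ x → (P x ⊎ Q x) × ¬ (P x × Q x)) xs →
                count P? xs + count Q? xs ≡ length xs
  count-split [] = refl
  count-split {x ∷ xs} ((_ , excl) ∷ es) with P? x
  ... | yes px = cong suc (trans (cong (_ +_) (count-reject Q? xs (λ qx → excl (px , qx)))) (count-split es))
  count-split {x ∷ xs} ((inj₁ px , _) ∷ es) | no ¬px = contradiction px ¬px
  count-split {x ∷ xs} ((inj₂ qx , _) ∷ es) | no ¬px =
    trans (cong (_ +_) (count-accept Q? xs qx)) (trans (+-suc _ _) (cong suc (count-split es)))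

count-none : {P : Pred A p} (P? : Decidable P) (xs : List A) → (∀ x → ¬ P x) → count P? xs ≡ 0
count-none P? [] ¬p = refl
count-none P? (x ∷ xs) ¬p = trans (count-reject P? xs (¬p x)) (count-none P? xs ¬p)

count-product : {R : Pred (A × A′) p} (R? : Decidable R) (xs : List A) (ys : List A′) →
  count R? (cartesianProduct xs ys) ≡ sum (map (λ x → count (λ y → R? (x , y)) ys) xs)
count-product R? [] ys = refl
count-product R? (x ∷ xs) ys =
  trans (count-++ R? (map (x ,_) ys) _)
        (cong₂ _+_ (count-map R? (x ,_) ys) (count-product R? xs ys))

module _ {R : B.REL A A′ p} (R? : B.Decidable R) where

  sum-count-∷ : ∀ x xs ys →
    sum (map (λ y → count (λ x → R? x y) (x ∷ xs)) ys) ≡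
    count (R? x) ys + sum (map (λ y → count (λ x → R? x y) xs) ys)
  sum-count-∷ x xs [] = refl
  sum-count-∷ x xs (y ∷ ys) with R? x y
  ... | yes _ = cong suc (trans (cong (_ +_) (sum-count-∷ x xs ys)) (x∙yz≈y∙xz (count (λ x → R? x y) xs) (count (R? x) ys) _))
  ... | no _ = trans (cong (_ +_) (sum-count-∷ x xs ys)) (x∙yz≈y∙xz (count (λ x → R? x y) xs) (count (R? x) ys) _)

  double-counting : ∀ xs ys →
    sum (map (λ x → count (R? x) ys) xs) ≡ sum (map (λ y → count (λ x → R? x y) xs) ys)
  double-counting [] [] = refl
  double-counting [] (y ∷ ys) = double-counting [] ys
  double-counting (x ∷ xs) ys =
    trans (cong (_ +_) (double-counting xs ys)) (sym (sum-count-∷ x xs ys))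

sum-≥ : (f : A → ℕ) (c : ℕ) {l : ℕ} → ∀ {xs} → All (λ x → l ≤ c * f x) xs →
  length xs * l ≤ c * sum (map f xs)
sum-≥ f c [] = z≤n
sum-≥ f c {xs = x ∷ xs} (l≤ ∷ ls) =
  ≤-trans (+-mono-≤ l≤ (sum-≥ f c ls)) (≤-reflexive (sym (*-distribˡ-+ c (f x) _)))

module _ {P : Pred A p} (P? : Decidable P) (f : A → ℕ) (c : ℕ) {h l : ℕ}
         (heavy : ∀ x → c * f x ≤ h) (light : ∀ x → ¬ P x → c * f x ≤ l) where

  -- Every element pays `l` and an element of `P` pays `h` on top, so a large sum forces many
  -- elements of `P`. The factor `c` clears the denominators of the averages this is applied to.
  sum-≤-heavy+light : ∀ xs → c * sum (map f xs) ≤ count P? xs * h + length xs * l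
  sum-≤-heavy+light [] = ≤-reflexive (*-zeroʳ c)
  sum-≤-heavy+light (x ∷ xs) with P? x
  ... | yes _ = begin
      c * (f x + sum (map f xs))                        ≡⟨ *-distribˡ-+ c (f x) _ ⟩
      c * f x + c * sum (map f xs)                      ≤⟨ +-mono-≤ (heavy x) (sum-≤-heavy+light xs) ⟩
      h + (count P? xs * h + length xs * l)             ≡⟨ +-assoc h _ _ ⟨
      h + count P? xs * h + length xs * l               ≤⟨ +-monoʳ-≤ (h + count P? xs * h) (m≤n+m _ l) ⟩
      h + count P? xs * h + (l + length xs * l)         ∎
      where open ≤-Reasoning
  ... | no ¬px = begin
      c * (f x + sum (map f xs))                        ≡⟨ *-distribˡ-+ c (f x) _ ⟩
      c * f x + c * sum (map f xs)                      ≤⟨ +-mono-≤ (light x ¬px) (sum-≤-heavy+light xs) ⟩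
      l + (count P? xs * h + length xs * l)             ≡⟨ x∙yz≈y∙xz l (count P? xs * h) _ ⟩
      count P? xs * h + (l + length xs * l)             ∎
      where open ≤-Reasoning

count-∁ : {P : Pred A p} (P? : Decidable P) (xs : List A) →
  count P? xs + count (¬? ∘ P?) xs ≡ length xs
count-∁ P? xs = count-split P? (¬? ∘ P?) (All.universal (λ x → toSum (P? x) , λ (px , ¬px) → ¬px px) xs)

-- Extremal and Ramsey theory

-- If both parts were smaller than `k`, then `m + n + 2 ≤ k + k`. The slack of one pays for the
-- vertex set aside in the Ramsey induction.
large-part : ∀ {k m n} → k + k ≤ suc (m + n) → k ≤ m ⊎ k ≤ n
large-part {k} {m} {n} 2k≤ with k ≤? m | k ≤? n
... | yes k≤m | _ = inj₁ k≤m
... | no _ | yes k≤n = inj₂ k≤n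
... | no k≰m | no k≰n = contradiction
  (≤-trans (≤-trans (≤-reflexive (cong suc (sym (+-suc m n)))) (+-mono-≤ (≰⇒> k≰m) (≰⇒> k≰n))) 2k≤)
  1+n≰n

AllPairs-resp-⊆ : {R : B.Rel A p} {xs ys : List A} → xs ⊆ ys → AllPairs R ys → AllPairs R xs
AllPairs-resp-⊆ [] [] = []
AllPairs-resp-⊆ (_ ∷ʳ τ) (_ ∷ rs) = AllPairs-resp-⊆ τ rs
AllPairs-resp-⊆ (refl ∷ τ) (r ∷ rs) = All-resp-⊆ τ r ∷ AllPairs-resp-⊆ τ rs

AllPairs-lookup : {R : B.Rel A p} → B.Symmetric R → ∀ {xs} → AllPairs R xs →
  ∀ {i j} → i ≢ j → R (lookup xs i) (lookup xs j)
AllPairs-lookup sym (_ ∷ _) {zero} {zero} i≢j = contradiction refl i≢j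
AllPairs-lookup sym {xs = _ ∷ xs} (r ∷ _) {zero} {suc j} _ = All.lookup r (∈-lookup j)
AllPairs-lookup sym {xs = _ ∷ xs} (r ∷ _) {suc i} {zero} _ = sym (All.lookup r (∈-lookup i))
AllPairs-lookup sym (_ ∷ rs) {suc i} {suc j} i≢j = AllPairs-lookup sym rs (i≢j ∘ cong suc)

All-⊎-split : {P : Pred A p} {Q : Pred A q} {xs : List A} → All (λ x → P x ⊎ Q x) xs →
  ∃[ ys ] ∃[ zs ] (ys ⊆ xs × zs ⊆ xs × All P ys × All Q zs × length ys + length zs ≡ length xs)
All-⊎-split [] = [] , [] , ⊆-refl , ⊆-refl , [] , [] , refl
All-⊎-split {xs = x ∷ xs} (r ∷ rs) with r | All-⊎-split rs
... | inj₁ px | ys , zs , ys⊆ , zs⊆ , ps , qs , eq = x ∷ ys , zs , refl ∷ ys⊆ , x ∷ʳ zs⊆ , px ∷ ps , qs , cong suc eq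
... | inj₂ qx | ys , zs , ys⊆ , zs⊆ , ps , qs , eq =
  ys , x ∷ zs , x ∷ʳ ys⊆ , refl ∷ zs⊆ , ps , qx ∷ qs , trans (+-suc _ _) (cong suc eq)

larger-half : {P : Pred A p} (P? : Decidable P) (xs : List A) →
  ∃[ ys ] (ys ⊆ xs × length xs ≤ 2 * length ys × (All P ys ⊎ All (¬_ ∘ P) ys))
larger-half P? xs with ≤-total (count P? xs) (count (¬? ∘ P?) xs)
... | inj₁ ≤₁ = filter (¬? ∘ P?) xs , filter-⊆ _ xs
  , ≤-trans (≤-reflexive (sym (count-∁ P? xs))) (+-mono-≤ ≤₁ (m≤m+n _ 0)) , inj₂ (All.all-filter _ xs)
... | inj₂ ≤₂ = filter P? xs , filter-⊆ _ xs
  , ≤-trans (≤-reflexive (sym (count-∁ P? xs))) (+-monoʳ-≤ _ (≤-trans ≤₂ (m≤m+n _ 0))) , inj₁ (All.all-filter _ xs)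

-- For each row in turn the columns shrink to the larger of its neighbourhood and its
-- non-neighbourhood, which costs a factor of at most 2 per row. The rows are all kept; both
-- Kővári-Sós-Turán and the bipartite Ramsey theorem then choose among them.
homogenize : {R : B.REL A A′ p} (R? : B.Decidable R) → ∀ xs ys →
  ∃[ zs ] (zs ⊆ ys × length ys ≤ 2 ^ length xs * length zs ×
           All (λ x → All (R x) zs ⊎ All (¬_ ∘ R x) zs) xs)
homogenize R? [] ys = ys , ⊆-refl , m≤m+n _ 0 , []
homogenize R? (x ∷ xs) ys with larger-half (R? x) ys
... | ys′ , ys′⊆ , ≤₁ , h with homogenize R? xs ys′
... | zs , zs⊆ , ≤₂ , hs = zs , ⊆-trans zs⊆ ys′⊆
  , ≤-trans ≤₁ (≤-trans (*-monoʳ-≤ 2 ≤₂) (≤-reflexive (sym (*-assoc 2 (2 ^ length xs) (length zs)))))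
  , restrict h ∷ hs
  where
  restrict : ∀ {U V : Pred _ _} → All U ys′ ⊎ All V ys′ → All U zs ⊎ All V zs
  restrict (inj₁ u) = inj₁ (All-resp-⊆ zs⊆ u)
  restrict (inj₂ v) = inj₂ (All-resp-⊆ zs⊆ v)

module _ {R : B.REL A A′ p} (R? : B.Decidable R) (ys : List A′) where

  private
    n : ℕ
    n = length ys

    degree : A → ℕ
    degree x = count (R? x) ys

    Heavy : A → Set
    Heavy x = n ≤ 16 * degree x

    heavy? : Decidable Heavy
    heavy? x = n ≤? 16 * degree x

  -- n²/8 edges give at least n/16 rows of degree ≥ n/16; 32t of these rows give at
  -- least n/32 columns meeting t of them, and columns with the same trace on the
  -- chosen rows then span the complete bipartite graph.
  many-heavy-rows : ∀ xs → .{{_ : NonZero n}} → length xs ≡ n →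
    n * n ≤ 8 * count (λ (x , y) → R? x y) (cartesianProduct xs ys) →
    n ≤ 16 * count heavy? xs
  many-heavy-rows xs ∣xs∣ dense = *-cancelʳ-≤ n _ n (+-cancelʳ-≤ (n * n) (n * n) _ (begin
    n * n + n * n                                    ≤⟨ +-mono-≤ dense dense ⟩
    8 * K + 8 * K                                    ≡⟨ eq₁ K ⟩
    16 * K                                           ≡⟨ cong (16 *_) (count-product _ xs ys) ⟩
    16 * sum (map degree xs)                         ≤⟨ sum-≤-heavy+light heavy? degree 16
                                                          (λ x → *-monoʳ-≤ 16 (length-filter (R? x) ys))
                                                          (λ x → ≰⇒≥) xs ⟩
    count heavy? xs * (16 * n) + length xs * n       ≡⟨ cong₂ _+_ (eq₂ (count heavy? xs) n) (cong (_* n) ∣xs∣) ⟩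
    16 * count heavy? xs * n + n * n                 ∎))
    where
    open ≤-Reasoning
    K = count (λ (x , y) → R? x y) (cartesianProduct xs ys)
    eq₁ : ∀ k → 8 * k + 8 * k ≡ 16 * k
    eq₁ = solve-∀
    eq₂ : ∀ h n → h * (16 * n) ≡ 16 * h * n
    eq₂ = solve-∀

  -- The `32 * t` heavy rows carry at least `2 * t * n` incidences. Columns meeting fewer than `t`
  -- rows account for at most `t * n` of them, and each of the others for at most `32 * t`.
  many-heavy-columns : ∀ xs t .{{_ : NonZero t}} → length xs ≡ 32 * t → All Heavy xs →
    n ≤ 32 * count (λ y → t ≤? count (λ x → R? x y) xs) ys
  many-heavy-columns xs t ∣xs∣ heavy = *-cancelˡ-≤ (16 * t) {{m*n≢0 16 t}} (+-cancelʳ-≤ (n * (16 * t)) (16 * t * n) _ (begin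
    16 * t * n + n * (16 * t)                        ≡⟨ eq₁ t n ⟩
    32 * t * n                                       ≡⟨ cong (_* n) ∣xs∣ ⟨
    length xs * n                                    ≤⟨ sum-≥ degree 16 heavy ⟩
    16 * sum (map degree xs)                         ≡⟨ cong (16 *_) (double-counting R? xs ys) ⟩
    16 * sum (map codegree ys)                       ≤⟨ sum-≤-heavy+light good? codegree 16
                                                          (λ y → *-monoʳ-≤ 16 (length-filter _ xs))
                                                          (λ y ¬g → *-monoʳ-≤ 16 (≰⇒≥ ¬g)) ys ⟩
    count good? ys * (16 * length xs) + n * (16 * t) ≡⟨ cong (_+ n * (16 * t)) (trans (cong (λ l → count good? ys * (16 * l)) ∣xs∣) (eq₂ (count good? ys) t)) ⟩
    16 * t * (32 * count good? ys) + n * (16 * t)    ∎))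
    where
    open ≤-Reasoning
    codegree : A′ → ℕ
    codegree y = count (λ x → R? x y) xs
    good? : Decidable (λ y → t ≤ codegree y)
    good? y = t ≤? codegree y
    eq₁ : ∀ t n → 16 * t * n + n * (16 * t) ≡ 32 * t * n
    eq₁ = solve-∀
    eq₂ : ∀ g t → g * (16 * (32 * t)) ≡ 16 * t * (32 * g)
    eq₂ = solve-∀

  -- One column `y` decides: it meets at least `t` rows, and a homogeneous row that meets `y` meets
  -- all of `vs`.
  complete-rows : ∀ {t} {us : List A} {vs : List A′} → 0 < length vs →
    All (λ x → All (R x) vs ⊎ All (¬_ ∘ R x) vs) us →
    All (λ y → t ≤ count (λ x → R? x y) us) vs →
    ∃[ ws ] (ws ⊆ us × t ≤ length ws × All (λ x → All (R x) vs) ws)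
  complete-rows {us = us} {y ∷ vs} _ homogeneous (t≤ ∷ _) =
    filter (λ x → R? x y) us , filter-⊆ _ us , t≤ ,
    All.zipWith complete (All.filter⁺ _ homogeneous , All.all-filter _ us)
    where
    complete : ∀ {x} → (All (R x) (y ∷ vs) ⊎ All (¬_ ∘ R x) (y ∷ vs)) × R x y → All (R x) (y ∷ vs)
    complete (inj₁ r , _) = r
    complete (inj₂ (¬r ∷ _) , r) = contradiction r ¬r

  -- The first lower bound on `n` provides the `32 * t` heavy rows. By the second, the `n / 32` or
  -- more heavy columns still leave `t` after division by the number of possible traces on those
  -- rows.
  kővári-sós-turán : ∀ xs t .{{_ : NonZero t}} → length xs ≡ n →
    n * n ≤ 8 * count (λ (x , y) → R? x y) (cartesianProduct xs ys) →
    16 * (32 * t) ≤ n → 32 * (2 ^ (32 * t) * t) ≤ n →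
    ∃[ us ] ∃[ vs ] (us ⊆ xs × vs ⊆ ys × t ≤ length us × t ≤ length vs × All (λ x → All (R x) vs) us)
  kővári-sós-turán xs t ∣xs∣ dense n≥₁ n≥₂ =
    let vs , vs⊆ , large , homogeneous = homogenize R? rows columns
        t≤∣vs∣ = *-cancelˡ-≤ (2 ^ (32 * t)) {{m^n≢0 2 (32 * t)}} (begin
          2 ^ (32 * t) * t              ≤⟨ *-cancelˡ-≤ 32 (≤-trans n≥₂ (many-heavy-columns rows t ∣rows∣ heavy)) ⟩
          length columns                ≤⟨ large ⟩
          2 ^ length rows * length vs   ≡⟨ cong (λ k → 2 ^ k * length vs) ∣rows∣ ⟩
          2 ^ (32 * t) * length vs      ∎)
        us , us⊆ , t≤∣us∣ , complete =
          complete-rows (≤-trans (>-nonZero⁻¹ t) t≤∣vs∣) homogeneous (All-resp-⊆ vs⊆ (All.all-filter _ ys))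
    in us , vs , ⊆-trans us⊆ (⊆-trans (take-⊆ (32 * t) _) (filter-⊆ _ xs)) , ⊆-trans vs⊆ (filter-⊆ _ ys)
       , t≤∣us∣ , t≤∣vs∣ , complete
    where
    open ≤-Reasoning
    instance
      _ : NonZero n
      _ = >-nonZero (≤-trans (>-nonZero⁻¹ (16 * (32 * t)) {{m*n≢0 16 (32 * t) {{_}} {{m*n≢0 32 t}}}}) n≥₁)
    rows : List A
    -- Keeping exactly `32 * t` heavy rows bounds the number of traces by `2 ^ (32 * t)`.
    rows = take (32 * t) (filter heavy? xs)
    columns : List A′
    columns = filter (λ y → t ≤? count (λ x → R? x y) rows) ys
    heavy : All Heavy rows
    heavy = All.take⁺ (32 * t) (All.all-filter _ xs)
    ∣rows∣ : length rows ≡ 32 * t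
    ∣rows∣ = trans (length-take (32 * t) (filter heavy? xs))
      (m≤n⇒m⊓n≡m (*-cancelˡ-≤ 16 (≤-trans n≥₁ (many-heavy-rows xs ∣xs∣ dense))))

-- Monochromatic cliques and complete bipartite graphs in a 2-coloring

colour : ∀ {n} → Coloring n → Bool → Graph n
colour c true = R c
colour c false = B c

module _ {n : ℕ} (c : Coloring n) where

  open import Data.List.Membership.DecPropositional (Fin._≟_ {n}) using (_∈?_)

  Coloured : Bool → B.Rel (Fin n) 0ℓ
  Coloured k = Adj (colour c k)

  coloured-irrefl : ∀ k {x} → ¬ Coloured k x x
  coloured-irrefl k = loopless (colour c k) refl

  coloured-sym : ∀ k {x y} → Coloured k x y → Coloured k y x
  coloured-sym k = symmetric (colour c k)

  other-colour : ∀ k {x y} → x ≢ y → ¬ Coloured k x y → Coloured (not k) x y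
  other-colour true x≢y ¬r with cover c _ _ x≢y
  ... | inj₁ r = contradiction r ¬r
  ... | inj₂ b = b
  other-colour false x≢y ¬b with cover c _ _ x≢y
  ... | inj₁ r = r
  ... | inj₂ b = contradiction b ¬b

  one-colour : ∀ k {x y} → Coloured k x y → ¬ Coloured (not k) x y
  one-colour true r b = disjoint c _ _ (r , b)
  one-colour false b r = disjoint c _ _ (r , b)

  Clique : Bool → List (Fin n) → Set
  Clique k = AllPairs (Coloured k)

  Complete : Bool → List (Fin n) → List (Fin n) → Set
  Complete k xs ys = All (λ x → All (Coloured k x) ys) xs

  Complete-sym : ∀ k {xs ys} → Complete k xs ys → Complete k ys xs
  Complete-sym k {xs} {ys} complete = All.tabulate λ y∈ → All.tabulate λ x∈ →
    coloured-sym k (All.lookup (All.lookup complete x∈) y∈)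

  Complete-resp-⊆ : ∀ k {xs xs′ ys ys′} → xs′ ⊆ xs → ys′ ⊆ ys → Complete k xs ys → Complete k xs′ ys′
  Complete-resp-⊆ k xs′⊆ ys′⊆ = All.map (All-resp-⊆ ys′⊆) ∘ All-resp-⊆ xs′⊆

  -- The usual induction: among the vertices after the first one, `x`, either the red neighbours of
  -- `x` or the remaining vertices number at least half of the bound. By `Unique` the latter differ
  -- from `x`, so they are its blue neighbours.
  ramsey : ∀ s t xs → Unique xs → 2 ^ (s + t) ≤ length xs →
    (∃[ ys ] (ys ⊆ xs × length ys ≡ s × Clique true ys)) ⊎
    (∃[ ys ] (ys ⊆ xs × length ys ≡ t × Clique false ys))
  ramsey zero t xs _ _ = inj₁ ([] , minimum xs , refl , [])
  ramsey (suc s) zero xs _ _ = inj₂ ([] , minimum xs , refl , [])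
  ramsey (suc s) (suc t) [] _ large = contradiction large (<⇒≱ (m^n>0 2 (suc s + suc t)))
  ramsey (suc s) (suc t) (x ∷ xs) (x∉ ∷ unique) large with
    large-part {2 ^ (s + suc t)} {count (adj? (R c) x) xs} {count (¬? ∘ adj? (R c) x) xs}
      (≤-trans (≤-reflexive (cong (2 ^ (s + suc t) +_) (sym (+-identityʳ _))))
        (≤-trans large (s≤s (≤-reflexive (sym (count-∁ (adj? (R c) x) xs))))))
  ... | inj₁ large′ with ramsey s (suc t) (filter (adj? (R c) x) xs) (AllPairs-resp-⊆ (filter-⊆ _ xs) unique) large′
  ... | inj₂ (ys , ys⊆ , ∣ys∣ , clique) = inj₂ (ys , x ∷ʳ ⊆-trans ys⊆ (filter-⊆ _ xs) , ∣ys∣ , clique)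
  ... | inj₁ (ys , ys⊆ , ∣ys∣ , clique) = inj₁ (x ∷ ys , refl ∷ ⊆-trans ys⊆ (filter-⊆ _ xs) , cong suc ∣ys∣ ,
    All-resp-⊆ ys⊆ (All.all-filter _ xs) ∷ clique)
  ramsey (suc s) (suc t) (x ∷ xs) (x∉ ∷ unique) large | inj₂ large′
    with ramsey (suc s) t (filter (¬? ∘ adj? (R c) x) xs) (AllPairs-resp-⊆ (filter-⊆ _ xs) unique)
           (subst (λ e → 2 ^ e ≤ count (¬? ∘ adj? (R c) x) xs) (+-suc s t) large′)
  ... | inj₁ (ys , ys⊆ , ∣ys∣ , clique) = inj₁ (ys , x ∷ʳ ⊆-trans ys⊆ (filter-⊆ _ xs) , ∣ys∣ , clique)
  ... | inj₂ (ys , ys⊆ , ∣ys∣ , clique) = inj₂ (x ∷ ys , refl ∷ ⊆-trans ys⊆ (filter-⊆ _ xs) , cong suc ∣ys∣ ,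
    All-resp-⊆ ys⊆ (All.zipWith (λ (x≢y , ¬r) → other-colour true x≢y ¬r)
      (All-resp-⊆ (filter-⊆ _ xs) x∉ , All.all-filter _ xs)) ∷ clique)

  diagonal-ramsey : ∀ s xs → Unique xs → 2 ^ (s + s) ≤ length xs →
    ∃[ k ] ∃[ ys ] (ys ⊆ xs × length ys ≡ s × Clique k ys)
  diagonal-ramsey s xs unique large with ramsey s s xs unique large
  ... | inj₁ red = true , red
  ... | inj₂ blue = false , blue

  -- After homogenizing, each of the `t + t` rows sees `vs` in a single colour, and the more
  -- frequent colour has at least `t` rows.
  bipartite-ramsey : ∀ t xs ys → length xs ≡ t + t → 2 ^ (t + t) * t ≤ length ys →
    All (λ x → All (x ≢_) ys) xs →
    ∃[ k ] ∃[ us ] ∃[ vs ] (us ⊆ xs × vs ⊆ ys × t ≤ length us × t ≤ length vs × Complete k us vs)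
  bipartite-ramsey t xs ys ∣xs∣ large xs≢ys =
    let vs , vs⊆ , large′ , homogeneous = homogenize (adj? (R c)) xs ys
        t≤∣vs∣ = *-cancelˡ-≤ (2 ^ (t + t)) {{m^n≢0 2 (t + t)}}
          (≤-trans large (≤-trans large′ (≤-reflexive (cong (λ k → 2 ^ k * length vs) ∣xs∣))))
        reds , blues , reds⊆ , blues⊆ , red , ¬red , eq = All-⊎-split homogeneous
        blue = All.zipWith (λ (x≢ , ¬r) → All.zipWith (λ (x≢y , ¬rxy) → other-colour true x≢y ¬rxy) (x≢ , ¬r))
                 (All.map (All-resp-⊆ vs⊆) (All-resp-⊆ blues⊆ xs≢ys) , ¬red)
    in case large-part (≤-trans (≤-reflexive (sym (trans eq ∣xs∣))) (n≤1+n _)) of λ where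
         (inj₁ t≤) → true , reds , vs , reds⊆ , vs⊆ , t≤ , t≤∣vs∣ , red
         (inj₂ t≤) → false , blues , vs , blues⊆ , vs⊆ , t≤ , t≤∣vs∣ , blue

  -- For l = k the copy puts W into xs; for l = not k it puts X into xs and Y into ys.
  Pattern : ℕ → Set
  Pattern t = ∃[ k ] ∃[ l ] ∃[ xs ] ∃[ ys ]
    (t ≤ length xs × t ≤ length ys × Clique (not k) xs × Complete k xs ys × Clique l ys)

  clique-member : ∀ k {xs x y} → Clique k xs → x ∈ xs → y ∈ xs → x ≢ y → Coloured k x y
  clique-member k {xs} clique x∈ y∈ x≢y =
    subst₂ (Coloured k) (sym (lookup-index x∈)) (sym (lookup-index y∈))
      (AllPairs-lookup (coloured-sym k) clique λ i≡j → x≢y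
        (trans (lookup-index x∈) (trans (cong (lookup xs) i≡j) (sym (lookup-index y∈)))))

  -- Two common vertices would be joined by an edge that is both red and blue.
  small-overlap : ∀ {xs ys} → Clique true xs → Clique false ys → All (_∈ xs) ys → length ys ≤ 1
  small-overlap {ys = []} _ _ _ = z≤n
  small-overlap {ys = _ ∷ []} _ _ _ = s≤s z≤n
  small-overlap {ys = x ∷ y ∷ _} red ((b ∷ _) ∷ _) (x∈ ∷ y∈ ∷ _) =
    contradiction b (one-colour true (clique-member true red x∈ y∈ λ { refl → coloured-irrefl false b }))

  -- Making the cliques disjoint costs at most one blue vertex, hence the `suc`. Whichever colour
  -- `k` the bipartite Ramsey theorem returns, the clique of colour `not k` becomes the first part
  -- of the pattern and the clique of colour `k` the second, so here `l` equals `k`.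
  cliques⇒pattern : ∀ t xs ys → t + t ≤ length xs → suc (2 ^ (t + t) * t) ≤ length ys →
    Clique true xs → Clique false ys → Pattern t
  cliques⇒pattern t xs ys large-red large red blue
    with bipartite-ramsey t (take (t + t) xs) rest (trans (length-take (t + t) xs) (m≤n⇒m⊓n≡m large-red)) large-rest
           (All.tabulate λ x∈take → All.map (λ { y∉ refl → y∉ (Sublist-lookup (take-⊆ (t + t) xs) x∈take) }) (All.all-filter _ ys))
    where
    rest : List (Fin n)
    rest = filter (¬? ∘ (_∈? xs)) ys
    large-rest : 2 ^ (t + t) * t ≤ length rest
    large-rest = s≤s⁻¹ (≤-trans large (≤-trans (≤-reflexive (sym (count-∁ (_∈? xs) ys)))
      (+-monoˡ-≤ _ (small-overlap red (AllPairs-resp-⊆ (filter-⊆ _ ys) blue) (All.all-filter (_∈? xs) ys)))))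
  ... | true , us , vs , us⊆ , vs⊆ , t≤∣us∣ , t≤∣vs∣ , complete =
    true , true , vs , us , t≤∣vs∣ , t≤∣us∣
    , AllPairs-resp-⊆ (⊆-trans vs⊆ (filter-⊆ _ ys)) blue , Complete-sym true complete , AllPairs-resp-⊆ (⊆-trans us⊆ (take-⊆ (t + t) xs)) red
  ... | false , us , vs , us⊆ , vs⊆ , t≤∣us∣ , t≤∣vs∣ , complete =
    false , false , us , vs , t≤∣us∣ , t≤∣vs∣
    , AllPairs-resp-⊆ (⊆-trans us⊆ (take-⊆ (t + t) xs)) red , complete , AllPairs-resp-⊆ (⊆-trans vs⊆ (filter-⊆ _ ys)) blue

  -- Ramsey's theorem gives a clique in each part. If one of them has colour `not k`, it serves as
  -- the first part of a pattern and the other clique, of whatever colour, as the second. Otherwise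
  -- either one is a clique of colour `k`.
  complete⇒pattern⊎clique : ∀ k s t xs ys → t ≤ s → Unique xs → Unique ys →
    2 ^ (s + s) ≤ length xs → 2 ^ (s + s) ≤ length ys → Complete k xs ys →
    Pattern t ⊎ (∃[ zs ] (s ≤ length zs × Clique k zs))
  complete⇒pattern⊎clique k s t xs ys t≤s unique-xs unique-ys large-xs large-ys complete
    with diagonal-ramsey s xs unique-xs large-xs | diagonal-ramsey s ys unique-ys large-ys
  ... | k₁ , us , us⊆ , refl , clique-us | k₂ , vs , vs⊆ , ∣vs∣ , clique-vs
    with k₁ ≟ᵇ k | k₂ ≟ᵇ k
  ... | yes refl | yes refl = inj₂ (us , ≤-refl , clique-us)
  ... | no k₁≢k | _ = inj₁ (k , k₂ , us , vs , t≤s , ≤-trans t≤s (≤-reflexive (sym ∣vs∣))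
    , subst (λ j → Clique j us) (¬-not k₁≢k) clique-us , Complete-resp-⊆ k us⊆ vs⊆ complete , clique-vs)
  ... | yes _ | no k₂≢k = inj₁ (k , k₁ , vs , us , ≤-trans t≤s (≤-reflexive (sym ∣vs∣)) , t≤s
    , subst (λ j → Clique j vs) (¬-not k₂≢k) clique-vs , Complete-sym k (Complete-resp-⊆ k us⊆ vs⊆ complete) , clique-us)

  dense⇒pattern⊎clique : ∀ k s t K → t ≤ s → 2 ^ (s + s) ≤ K →
    16 * (32 * K) ≤ n → 32 * (2 ^ (32 * K) * K) ≤ n → n * n ≤ 8 * e (colour c k) →
    Pattern t ⊎ (∃[ zs ] (s ≤ length zs × Clique k zs))
  dense⇒pattern⊎clique k s t K t≤s large n≥₁ n≥₂ dense =
    let us , vs , us⊆ , vs⊆ , large-us , large-vs , complete =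
          -- Requiring `i < j` makes the number of related pairs equal to `e (colour c k)`; the
          -- order is dropped again at the end by `proj₂`.
          kővári-sós-turán (λ i j → (i Fin.<? j) ×-dec adj? (colour c k) i j) (allFin n) (allFin n)
            K {{>-nonZero (≤-trans (m^n>0 2 (s + s)) large)}} refl
            (subst (λ l → l * l ≤ 8 * e (colour c k)) (sym ∣allFin∣) dense)
            (≤-trans n≥₁ (≤-reflexive (sym ∣allFin∣)))
            (≤-trans n≥₂ (≤-reflexive (sym ∣allFin∣)))
    in complete⇒pattern⊎clique k s t us vs t≤s
         (AllPairs-resp-⊆ us⊆ (allFin⁺ n)) (AllPairs-resp-⊆ vs⊆ (allFin⁺ n))
         (≤-trans large large-us) (≤-trans large large-vs)
         (All.map (All.map proj₂) complete)
    where
    ∣allFin∣ : length (allFin n) ≡ n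
    ∣allFin∣ = length-tabulate {n = n} (λ i → i)

  -- A pattern can fail to appear at once only if both colours yield cliques of size `s`; the first
  -- two bounds on `s` are those under which a red and a blue clique combine into a pattern.
  dense⇒pattern : ∀ t s K → t + t ≤ s → suc (2 ^ (t + t) * t) ≤ s → 2 ^ (s + s) ≤ K →
    16 * (32 * K) ≤ n → 32 * (2 ^ (32 * K) * K) ≤ n →
    n * n ≤ 8 * e (R c) → n * n ≤ 8 * e (B c) → Pattern t
  dense⇒pattern t s K s≥₁ s≥₂ large n≥₁ n≥₂ dense-R dense-B =
    combine (dense⇒pattern⊎clique true s t K t≤s large n≥₁ n≥₂ dense-R)
            (dense⇒pattern⊎clique false s t K t≤s large n≥₁ n≥₂ dense-B)
    where
    t≤s : t ≤ s
    t≤s = ≤-trans (m≤m+n t t) s≥₁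
    combine : Pattern t ⊎ (∃[ xs ] (s ≤ length xs × Clique true xs)) →
              Pattern t ⊎ (∃[ ys ] (s ≤ length ys × Clique false ys)) → Pattern t
    combine (inj₁ pattern′) _ = pattern′
    combine (inj₂ _) (inj₁ pattern′) = pattern′
    combine (inj₂ (xs , large-xs , red)) (inj₂ (ys , large-ys , blue)) =
      cliques⇒pattern t xs ys (≤-trans s≥₁ large-xs) (≤-trans s≥₂ large-ys) red blue

-- Balanced copies

⌊/2⌋-complement : ∀ {k x y} → x + y ≡ k → x ≡ ⌊ k /2⌋ → y ≡ ⌈ k /2⌉
⌊/2⌋-complement {k} eq refl = +-cancelˡ-≡ ⌊ k /2⌋ _ _ (trans eq (sym (⌊n/2⌋+⌈n/2⌉≡n k)))

⌈/2⌉-complement : ∀ {k x y} → x + y ≡ k → x ≡ ⌈ k /2⌉ → y ≡ ⌊ k /2⌋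
⌈/2⌉-complement {k} eq refl = +-cancelˡ-≡ ⌈ k /2⌉ _ _
  (trans eq (trans (sym (⌊n/2⌋+⌈n/2⌉≡n k)) (+-comm ⌊ k /2⌋ ⌈ k /2⌉)))

edges-distinct : ∀ {n} (G : Graph n) → All (λ (i , j) → i ≢ j) (edges G)
edges-distinct G = All.map (λ { (i<j , _) refl → <-irrefl refl i<j }) (All.all-filter _ (cartesianProduct (allFin _) (allFin _)))

module _ {m n : ℕ} (G : Graph m) where

  countIn-copy : (H : Graph n) (φ : Fin m ↣ Fin n) → let open Injection φ using (to) in
    countIn H (copyEdges G φ) ≡ count (λ (i , j) → adj? H (to i) (to j)) (edges G)
  countIn-copy H φ = count-map (λ (i , j) → adj? H i j) (λ (i , j) → to i , to j) (edges G)
    where open Injection φ using (to)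

  module _ (c : Coloring n) where

    countIn-split : (φ : Fin m ↣ Fin n) →
      countIn (R c) (copyEdges G φ) + countIn (B c) (copyEdges G φ) ≡ e G
    countIn-split φ =
      trans (cong₂ _+_ (countIn-copy (R c) φ) (countIn-copy (B c) φ))
        (count-split _ _ (All.map (λ i≢j → cover c _ _ (i≢j ∘ injective) , disjoint c _ _) (edges-distinct G)))
      where open Injection φ using (injective)

    half⇒balanced : (φ : Fin m ↣ Fin n) → ∀ k → IsHalf (e G) (countIn (colour c k) (copyEdges G φ)) → BalancedCopy G c
    half⇒balanced φ true (inj₁ r) = inj₂ (φ , r , ⌊/2⌋-complement (countIn-split φ) r)
    half⇒balanced φ true (inj₂ r) = inj₁ (φ , r , ⌈/2⌉-complement (countIn-split φ) r)
    half⇒balanced φ false (inj₁ b) = inj₁ (φ , ⌊/2⌋-complement (trans (+-comm (countIn (B c) (copyEdges G φ)) _) (countIn-split φ)) b , b)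
    half⇒balanced φ false (inj₂ b) = inj₂ (φ , ⌈/2⌉-complement (trans (+-comm (countIn (B c) (copyEdges G φ)) _) (countIn-split φ)) b , b)

    balanced⇒half : BalancedCopy G c → ∃[ φ ] IsHalf (e G) (countIn (R c) (copyEdges G φ))
    balanced⇒half (inj₁ (φ , r , _)) = φ , inj₂ r
    balanced⇒half (inj₂ (φ , r , _)) = φ , inj₁ r

    -- The colours that a pattern gives to the image of a pair when `W` is mapped into its first
    -- clique and the complement of `W` into its second, by the position of the pair.
    data Placement (k l : Bool) (W : Subset m) (φ : Fin m → Fin n) (i j : Fin m) : Set where
      inside  : i Subset.∈ W → j Subset.∈ W → Coloured c (not k) (φ i) (φ j) → Placement k l W φ i j
      across  : i Subset.∈ W → j Subset.∉ W → Coloured c k (φ i) (φ j) → Placement k l W φ i j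
      across′ : i Subset.∉ W → j Subset.∈ W → Coloured c k (φ i) (φ j) → Placement k l W φ i j
      outside : i Subset.∉ W → j Subset.∉ W → Coloured c l (φ i) (φ j) → Placement k l W φ i j

    placement-distinct : ∀ {k l W φ i j} → Placement k l W φ i j → φ i ≢ φ j
    placement-distinct {k} (inside _ _ r) eq = coloured-irrefl c (not k) (subst (Coloured c (not k) _) (sym eq) r)
    placement-distinct {k} (across _ _ r) eq = coloured-irrefl c k (subst (Coloured c k _) (sym eq) r)
    placement-distinct {k} (across′ _ _ r) eq = coloured-irrefl c k (subst (Coloured c k _) (sym eq) r)
    placement-distinct {l = l} (outside _ _ r) eq = coloured-irrefl c l (subst (Coloured c l _) (sym eq) r)

    -- Distinct vertices have images joined by a coloured edge; since colour classes are loopless,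
    -- injectivity follows from the placement itself.
    pattern⇒placement : ((k , l , _) : Pattern c m) (W : Subset m) →
      Σ (Fin m ↣ Fin n) λ φ → ∀ {i j} → i ≢ j → Placement k l W (Injection.to φ) i j
    pattern⇒placement (k , l , xs , ys , m≤xs , m≤ys , clique-xs , complete , clique-ys) W =
      mk↣ {to = φ} injective , placed
      where
      f g φ : Fin m → Fin n
      -- Both lists have at least `m` entries, so a vertex uses its own index in either of them.
      f i = lookup xs (Fin.inject≤ i m≤xs)
      g i = lookup ys (Fin.inject≤ i m≤ys)
      φ i = if does (i Subset.∈? W) then f i else g i

      φ-inside : ∀ {i} → i Subset.∈ W → φ i ≡ f i
      φ-inside {i} i∈ = cong (λ b → if b then f i else g i) (dec-true (i Subset.∈? W) i∈)

      φ-outside : ∀ {i} → i Subset.∉ W → φ i ≡ g i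
      φ-outside {i} i∉ = cong (λ b → if b then f i else g i) (dec-false (i Subset.∈? W) i∉)

      recolour : ∀ d {u v x y} → u ≡ x → v ≡ y → Coloured c d x y → Coloured c d u v
      recolour d p q = subst₂ (Coloured c d) (sym p) (sym q)

      mixed : ∀ i j → Coloured c k (f i) (g j)
      mixed i j = All.lookup (All.lookup complete (∈-lookup (Fin.inject≤ i m≤xs))) (∈-lookup (Fin.inject≤ j m≤ys))

      placed : ∀ {i j} → i ≢ j → Placement k l W φ i j
      placed {i} {j} i≢j with i Subset.∈? W | j Subset.∈? W
      ... | yes i∈ | yes j∈ = inside i∈ j∈ (recolour (not k) (φ-inside i∈) (φ-inside j∈)
        (AllPairs-lookup (coloured-sym c (not k)) clique-xs (i≢j ∘ inject≤-injective m≤xs m≤xs i j)))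
      ... | yes i∈ | no j∉ = across i∈ j∉ (recolour k (φ-inside i∈) (φ-outside j∉) (mixed i j))
      ... | no i∉ | yes j∈ = across′ i∉ j∈ (recolour k (φ-outside i∉) (φ-inside j∈) (coloured-sym c k (mixed j i)))
      ... | no i∉ | no j∉ = outside i∉ j∉ (recolour l (φ-outside i∉) (φ-outside j∉)
        (AllPairs-lookup (coloured-sym c l) clique-ys (i≢j ∘ inject≤-injective m≤ys m≤ys i j)))

      injective : ∀ {i j} → φ i ≡ φ j → i ≡ j
      injective {i} {j} eq with i Fin.≟ j
      ... | yes i≡j = i≡j
      ... | no i≢j = contradiction eq (placement-distinct (placed i≢j))

    -- If `l` is `k`, the edges of colour `not k` in the copy are exactly those inside `W`.
    -- Otherwise `l` is `not k`, and the edges of colour `k` are exactly those between `X` and `Y`.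
    -- In either case one colour takes half of the edges.
    pattern⇒balanced : Pattern c m →
      (∃[ X ] ∃[ Y ] (IsPartition X Y × IsHalf (e G) (eBetween G X Y))) →
      (∃[ W ] IsHalf (e G) (eInduced G W)) → BalancedCopy G c
    pattern⇒balanced pat@(k , l , _) (X , Y , (X∪Y , X∩Y) , half-between) (W , half-induced) with l ≟ᵇ k
    ... | yes refl = half⇒balanced φ (not k) (subst (IsHalf (e G)) (sym eq) half-induced)
      where
      φ = proj₁ (pattern⇒placement pat W)
      open Injection φ using (to)
      induced : ∀ {i j} → Placement k k W to i j →
        Coloured c (not k) (to i) (to j) ⇔ (i Subset.∈ W × j Subset.∈ W)
      induced (inside i∈ j∈ r) = mk⇔ (λ _ → i∈ , j∈) (λ _ → r)
      induced (across _ j∉ r) = mk⇔ (λ r′ → contradiction r′ (one-colour c k r)) (λ (_ , j∈) → contradiction j∈ j∉)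
      induced (across′ i∉ _ r) = mk⇔ (λ r′ → contradiction r′ (one-colour c k r)) (λ (i∈ , _) → contradiction i∈ i∉)
      induced (outside i∉ _ r) = mk⇔ (λ r′ → contradiction r′ (one-colour c k r)) (λ (i∈ , _) → contradiction i∈ i∉)
      eq : countIn (colour c (not k)) (copyEdges G φ) ≡ eInduced G W
      eq = trans (countIn-copy (colour c (not k)) φ)
        (count-cong _ _ (All.map (λ i≢j → induced (proj₂ (pattern⇒placement pat W) i≢j)) (edges-distinct G)))
    ... | no l≢k = half⇒balanced φ k (subst (IsHalf (e G)) (sym eq) half-between)
      where
      φ = proj₁ (pattern⇒placement pat X)
      open Injection φ using (to)
      inY : ∀ {i} → i Subset.∉ X → i Subset.∈ Y
      inY {i} i∉ with Subset.x∈p∪q⁻ X Y (subst (i Subset.∈_) (sym X∪Y) Subset.∈⊤)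
      ... | inj₁ i∈X = contradiction i∈X i∉
      ... | inj₂ i∈Y = i∈Y
      notY : ∀ {i} → i Subset.∈ X → i Subset.∉ Y
      notY {i} i∈X i∈Y = Subset.∉⊥ (subst (i Subset.∈_) X∩Y (Subset.x∈p∩q⁺ (i∈X , i∈Y)))
      between : ∀ {i j} → Placement k l X to i j →
        Coloured c k (to i) (to j) ⇔ ((i Subset.∈ X × j Subset.∈ Y) ⊎ (i Subset.∈ Y × j Subset.∈ X))
      between (inside i∈ j∈ r) = mk⇔ (λ r′ → contradiction r (one-colour c k r′))
        (λ { (inj₁ (_ , j∈Y)) → contradiction j∈Y (notY j∈) ; (inj₂ (i∈Y , _)) → contradiction i∈Y (notY i∈) })
      between (across i∈ j∉ r) = mk⇔ (λ _ → inj₁ (i∈ , inY j∉)) (λ _ → r)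
      between (across′ i∉ j∈ r) = mk⇔ (λ _ → inj₂ (inY i∉ , j∈)) (λ _ → r)
      between {i} {j} (outside i∉ j∉ r) = mk⇔
        (λ r′ → contradiction (subst (λ d → Coloured c d (to i) (to j)) (¬-not l≢k) r) (one-colour c k r′))
        (λ { (inj₁ (i∈ , _)) → contradiction i∈ i∉ ; (inj₂ (_ , j∈)) → contradiction j∈ j∉ })
      eq : countIn (colour c k) (copyEdges G φ) ≡ eBetween G X Y
      eq = trans (countIn-copy (colour c k) φ)
        (count-cong _ _ (All.map (λ i≢j → between (proj₂ (pattern⇒placement pat X) i≢j)) (edges-distinct G)))

-- Decidability of Forces, hence existence of bal

least : {P : ℕ → Set p} → Decidable P → ∀ k → P k → ∃[ s ] (P s × s ≤ k × (∀ t → P t → s ≤ t))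
least P? zero p = zero , p , z≤n , λ _ _ → z≤n
least P? (suc k) p with P? zero
... | yes p₀ = zero , p₀ , z≤n , λ _ _ → z≤n
... | no ¬p₀ with least (P? ∘ suc) k p
... | s , ps , s≤k , minimal = suc s , ps , s≤s s≤k ,
  λ { zero p₀ → contradiction p₀ ¬p₀ ; (suc t) pt → s≤s (minimal t pt) }

-- Serves two searches: vectors of vertices are the candidate copies, and vectors of subsets are the
-- candidate colorings.
anyVec? : {A : Set} → (∀ {P : A → Set} → Decidable P → Dec (∃ P)) →
  ∀ {n} {P : Vec A n → Set} → Decidable P → Dec (∃ P)
anyVec? search {zero} P? = map′ ([] ,_) (λ { ([] , p) → p }) (P? [])
anyVec? search {suc n} P? =
  map′ (λ (x , xs , p) → x ∷ xs , p) (λ { (x ∷ xs , p) → x , xs , p })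
    (search λ x → anyVec? search λ xs → P? (x ∷ xs))

∈-tabulate : ∀ {n} {P : Fin n → Set} (P? : Decidable P) {i} → i Subset.∈ Vec.tabulate (does ∘ P?) ⇔ P i
∈-tabulate {P = P} P? {i} = mk⇔ forth back
  where
  forth : i Subset.∈ Vec.tabulate (does ∘ P?) → P i
  forth i∈ with P? i | trans (sym (lookup∘tabulate (does ∘ P?) i)) ([]=⇒lookup i∈)
  ... | yes pi | _ = pi
  back : P i → i Subset.∈ Vec.tabulate (does ∘ P?)
  back pi = lookup⇒[]= i _ (trans (lookup∘tabulate (does ∘ P?) i) (dec-true (P? i) pi))

_≈_ : ∀ {n} → B.Rel (Graph n) 0ℓ
G ≈ H = ∀ {i j} → Adj G i j ⇔ Adj H i j

module _ {n : ℕ} (G H : Graph n) (G≈H : G ≈ H) where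

  countIn-cong : ∀ es → countIn G es ≡ countIn H es
  countIn-cong es = count-cong _ _ (All.universal (λ _ → G≈H) es)

  e-cong : e G ≡ e H
  e-cong = count-cong _ _ (All.universal
    (λ _ → mk⇔ (λ (i<j , r) → i<j , Equivalence.to G≈H r) (λ (i<j , r) → i<j , Equivalence.from G≈H r))
    (cartesianProduct (allFin n) (allFin n)))

module _ {m : ℕ} (G : Graph m) where

  coloredCopy? : ∀ {n} (c : Coloring n) r b → Dec (ColoredCopy G c r b)
  coloredCopy? {n} c r b = map′ forth back (anyVec? any? {P = IsCopy} isCopy?)
    where
    image : (Fin m → Fin n) → List (Fin n × Fin n)
    image φ = map (λ (i , j) → φ i , φ j) (edges G)

    IsCopy : Vec (Fin n) m → Set
    IsCopy v = (∀ i j → Vec.lookup v i ≡ Vec.lookup v j → i ≡ j) ×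
      countIn (R c) (image (Vec.lookup v)) ≡ r × countIn (B c) (image (Vec.lookup v)) ≡ b

    isCopy? : Decidable IsCopy
    isCopy? v = all? (λ i → all? λ j → (Vec.lookup v i Fin.≟ Vec.lookup v j) →-dec (i Fin.≟ j))
      ×-dec (countIn (R c) (image (Vec.lookup v)) ≟ r) ×-dec (countIn (B c) (image (Vec.lookup v)) ≟ b)

    forth : ∃ IsCopy → ColoredCopy G c r b
    forth (v , inj , eqR , eqB) = mk↣ {to = Vec.lookup v} (inj _ _) , eqR , eqB

    back : ColoredCopy G c r b → ∃ IsCopy
    back (φ , eqR , eqB) = Vec.tabulate to
      , (λ i j eq → injective (trans (sym (lookup∘tabulate to i)) (trans eq (lookup∘tabulate to j))))
      , trans (cong (countIn (R c)) same) eqR , trans (cong (countIn (B c)) same) eqB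
      where
      open Injection φ using (to; injective)
      -- Tabulating a vertex map preserves it pointwise, which is enough for the list of copied
      -- edges.
      same : image (Vec.lookup (Vec.tabulate to)) ≡ image to
      same = map-cong (λ (i , j) → cong₂ _,_ (lookup∘tabulate to i) (lookup∘tabulate to j)) (edges G)

  balancedCopy? : ∀ {n} (c : Coloring n) → Dec (BalancedCopy G c)
  balancedCopy? c = coloredCopy? c _ _ ⊎-dec coloredCopy? c _ _

  balancedCopy-resp-≈ : ∀ {n} {c d : Coloring n} → R c ≈ R d → B c ≈ B d → BalancedCopy G c → BalancedCopy G d
  balancedCopy-resp-≈ {c = c} {d} R≈ B≈ = Sum.map transport transport
    where
    transport : ∀ {r b} → ColoredCopy G c r b → ColoredCopy G d r b
    transport (φ , r , b) = φ , trans (sym (countIn-cong (R c) (R d) R≈ (copyEdges G φ))) r , trans (sym (countIn-cong (B c) (B d) B≈ (copyEdges G φ))) b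

-- Colorings from symmetric relations and from matrices

-- `P` may hold on the diagonal; the conjunct `i ≢ j` keeps both colour classes loopless. Both the
-- decoded matrices and the two extremal colorings arise in this way.
splitting : ∀ {n} (P : Fin n → Fin n → Set) → B.Decidable P → B.Symmetric P → Coloring n
splitting P P? P-sym = record
  { R = record { Adj = λ i j → i ≢ j × P i j ; adj? = λ i j → ¬? (i Fin.≟ j) ×-dec P? i j
               ; symmetric = λ (i≢j , p) → i≢j ∘ sym , P-sym p ; loopless = λ i≡j (i≢j , _) → i≢j i≡j }
  ; B = record { Adj = λ i j → i ≢ j × ¬ P i j ; adj? = λ i j → ¬? (i Fin.≟ j) ×-dec ¬? (P? i j)
               ; symmetric = λ (i≢j , ¬p) → i≢j ∘ sym , ¬p ∘ P-sym ; loopless = λ i≡j (i≢j , _) → i≢j i≡j }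
  ; cover = cover′
  ; disjoint = λ i j ((_ , p) , (_ , ¬p)) → ¬p p }
  where
  cover′ : ∀ i j → i ≢ j → (i ≢ j × P i j) ⊎ (i ≢ j × ¬ P i j)
  cover′ i j i≢j with P? i j
  ... | yes p = inj₁ (i≢j , p)
  ... | no ¬p = inj₂ (i≢j , ¬p)

module _ {n : ℕ} where

  -- Colorings carry arbitrary predicates; up to equivalence they are finitely many.
  decode : Vec (Subset n) n → Coloring n
  decode M = splitting (λ i j → j Subset.∈ Vec.lookup M i ⊎ i Subset.∈ Vec.lookup M j)
    (λ i j → (j Subset.∈? Vec.lookup M i) ⊎-dec (i Subset.∈? Vec.lookup M j)) Sum.swap

  encode : Coloring n → Vec (Subset n) n
  encode c = Vec.tabulate λ i → Vec.tabulate λ j → does (adj? (R c) i j)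

  -- An arbitrary matrix is symmetrized by `decode`; on the matrix of `R c` this adds nothing, as
  -- that graph is symmetric.
  R-decode-encode : ∀ c → R (decode (encode c)) ≈ R c
  R-decode-encode c {i} {j} = mk⇔
    (λ { (_ , inj₁ j∈) → Equivalence.to entry j∈ ; (_ , inj₂ i∈) → symmetric (R c) (Equivalence.to entry i∈) })
    (λ r → (λ i≡j → loopless (R c) i≡j r) , inj₁ (Equivalence.from entry r))
    where
    entry : ∀ {i j} → j Subset.∈ Vec.lookup (encode c) i ⇔ Adj (R c) i j
    entry {i} {j} = subst (λ S → j Subset.∈ S ⇔ Adj (R c) i j)
      (sym (lookup∘tabulate (λ i → Vec.tabulate λ j → does (adj? (R c) i j)) i)) (∈-tabulate (adj? (R c) i))

  -- Blue is the complement of red in both colorings, so the agreement of the red graphs carries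
  -- over.
  B-decode-encode : ∀ c → B (decode (encode c)) ≈ B c
  B-decode-encode c = mk⇔
    (λ b → other-colour c true (λ { refl → loopless (B (decode (encode c))) refl b })
       λ r → disjoint (decode (encode c)) _ _ (Equivalence.from (R-decode-encode c) r , b))
    (λ b → other-colour (decode (encode c)) true (λ { refl → loopless (B c) refl b })
       λ r → disjoint c _ _ (Equivalence.to (R-decode-encode c) r , b))

-- A counterexample need only be sought among the finitely many decoded matrices, because edge
-- counts and balanced copies are invariant under `≈`. Deciding `Forces` is what allows its least
-- bound to be found.
forces? : ∀ {m} n (G : Graph m) t → Dec (Forces n G t)
forces? n G t = map′ forth back (¬? (anyVec? anySubset? {P = Bad} bad?))
  where
  Bad : Vec (Subset n) n → Set
  Bad M = t < e (R (decode M)) ⊓ e (B (decode M)) × ¬ BalancedCopy G (decode M)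

  bad? : Decidable Bad
  bad? M = (t <? e (R (decode M)) ⊓ e (B (decode M))) ×-dec ¬? (balancedCopy? G (decode M))

  forth : ¬ ∃ Bad → Forces n G t
  forth none c t< = balancedCopy-resp-≈ G {c = decode (encode c)} {c} (R-decode-encode c) (B-decode-encode c)
    -- The failed search only excludes the absence of a balanced copy; decidability turns this into
    -- a copy.
    (decidable-stable (balancedCopy? G (decode (encode c))) λ unbalanced → none (encode c ,
      subst (t <_) (sym (cong₂ _⊓_
        (e-cong (R (decode (encode c))) (R c) (R-decode-encode c))
        (e-cong (B (decode (encode c))) (B c) (B-decode-encode c)))) t< , unbalanced))

  back : Forces n G t → ¬ ∃ Bad
  back forces (M , t< , unbalanced) = unbalanced (forces (decode M) t<)

-- Colorings with exactly half of the edges in each colour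

count-× : {P : Pred A p} {Q : Pred A q} (P? : Decidable P) (Q? : Decidable Q) (xs : List A) →
  count (λ x → P? x ×-dec Q? x) xs + count (λ x → P? x ×-dec ¬? (Q? x)) xs ≡ count P? xs
count-× P? Q? [] = refl
count-× P? Q? (x ∷ xs) with P? x | Q? x
... | yes _ | yes _ = cong suc (count-× P? Q? xs)
... | yes _ | no _ = trans (+-suc _ _) (cong suc (count-× P? Q? xs))
... | no _ | _ = count-× P? Q? xs

allFin-suc : ∀ n → tabulate {n = n} Fin.suc ≡ map Fin.suc (allFin n)
allFin-suc n = sym (map-tabulate id Fin.suc)

count-Fin-suc : ∀ {n} {P : Pred (Fin (suc n)) p} (P? : Decidable P) →
  count P? (tabulate Fin.suc) ≡ count (P? ∘ suc) (allFin n)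
count-Fin-suc {n = n} P? = trans (cong (count P?) (allFin-suc n)) (count-map P? suc (allFin n))

count-below : ∀ a b → count (λ (j : Fin (a + b)) → toℕ j <? a) (allFin (a + b)) ≡ a
count-below zero b = count-none _ (allFin b) (λ _ ())
count-below (suc a) b = trans (count-accept (λ (j : Fin (suc a + b)) → toℕ j <? suc a) (tabulate Fin.suc) (s≤s z≤n))
  (cong suc (trans (count-Fin-suc (λ (j : Fin (suc (a + b))) → toℕ j <? suc a))
    (trans (count-cong _ _ (All.universal (λ j → mk⇔ s≤s⁻¹ s≤s) (allFin (a + b)))) (count-below a b))))

count-above : ∀ a b → count (λ (j : Fin (a + b)) → a ≤? toℕ j) (allFin (a + b)) ≡ b
count-above a b = +-cancelˡ-≡ a _ _ (trans
  (cong (_+ count (λ j → a ≤? toℕ j) (allFin (a + b))) (sym (count-below a b)))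
  (trans (count-split _ _ (All.universal (λ j → <-≤-connex (toℕ j) a , λ (j<a , a≤j) → <⇒≱ j<a a≤j) (allFin (a + b))))
    (length-tabulate {n = a + b} id)))

-- Enumerated in the same way as `edges`, so that `e G` is `pairs (adj? G)` by definition.
pairs : ∀ {n} {P : B.Rel (Fin n) p} → B.Decidable P → ℕ
pairs {n = n} P? = count (λ (i , j) → (i Fin.<? j) ×-dec P? i j) (cartesianProduct (allFin n) (allFin n))

pairs-cong : ∀ {n} {P : B.Rel (Fin n) p} {Q : B.Rel (Fin n) q} (P? : B.Decidable P) (Q? : B.Decidable Q) →
  (∀ {i j} → i Fin.< j → P i j ⇔ Q i j) → pairs P? ≡ pairs Q?
pairs-cong {n = n} P? Q? e = count-cong _ _ (All.universal
  (λ _ → mk⇔ (λ (i<j , pij) → i<j , Equivalence.to (e i<j) pij) (λ (i<j , qij) → i<j , Equivalence.from (e i<j) qij))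
  (cartesianProduct (allFin n) (allFin n)))

-- Vertex `zero` precedes all others, so it occurs only as a first entry and its row needs no order
-- condition.
pairs-suc : ∀ {n} {P : B.Rel (Fin (suc n)) p} (P? : B.Decidable P) →
  pairs P? ≡ count (λ j → P? zero (suc j)) (allFin n) + pairs (λ i j → P? (suc i) (suc j))
pairs-suc {n = n} P? = begin
  pairs P?                                                     ≡⟨ count-product (λ (i , j) → (i Fin.<? j) ×-dec P? i j) (allFin (suc n)) (allFin (suc n)) ⟩
  row zero + sum (map row (tabulate Fin.suc))                      ≡⟨ cong₂ _+_ row-zero (cong sum rows-suc) ⟩
  count (λ j → P? zero (suc j)) (allFin n) + sum (map row′ (allFin n))
    ≡⟨ cong (count (λ j → P? zero (suc j)) (allFin n) +_) (count-product _ (allFin n) (allFin n)) ⟨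
  count (λ j → P? zero (suc j)) (allFin n) + pairs (λ i j → P? (suc i) (suc j)) ∎
  where
  open ≡-Reasoning
  row : Fin (suc n) → ℕ
  row i = count (λ j → (i Fin.<? j) ×-dec P? i j) (allFin (suc n))
  row′ : Fin n → ℕ
  row′ i = count (λ j → (i Fin.<? j) ×-dec P? (suc i) (suc j)) (allFin n)
  row-zero : row zero ≡ count (λ j → P? zero (suc j)) (allFin n)
  row-zero = trans (count-Fin-suc (λ j → (Fin.zero {n} Fin.<? j) ×-dec P? zero j))
    (count-cong _ _ (All.universal (λ j → mk⇔ proj₂ (s≤s z≤n ,_)) (allFin n)))
  row-suc : ∀ i → row (suc i) ≡ row′ i
  row-suc i = trans (count-Fin-suc (λ j → (suc i Fin.<? j) ×-dec P? (suc i) j))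
    (count-cong _ _ (All.universal (λ j → mk⇔ (λ (i<j , pij) → s≤s⁻¹ i<j , pij) (λ (i<j , pij) → s≤s i<j , pij)) (allFin n)))
  rows-suc : map row (tabulate Fin.suc) ≡ map row′ (allFin n)
  rows-suc = trans (map-tabulate Fin.suc row) (trans (sym (map-tabulate id (row ∘ Fin.suc))) (map-cong row-suc (allFin n)))

suc-C-2 : ∀ n → suc n C 2 ≡ n + n C 2
suc-C-2 n = trans (sym (nCk+nC[k+1]≡[n+1]C[k+1] n 1)) (cong (_+ n C 2) (nC1≡n n))

-- For `i < j` both ends lie among the first `a` vertices as soon as `j` does. Deleting vertex
-- `zero` from a clique on `suc a` vertices removes `a` pairs, as in `suc-C-2`.
pairs-clique : ∀ a b {P : B.Rel (Fin (a + b)) p} (P? : B.Decidable P) →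
  (∀ {i j} → i Fin.< j → P i j ⇔ toℕ j < a) → pairs P? ≡ a C 2
pairs-clique zero b P? e = count-none _ (cartesianProduct (allFin b) (allFin b))
  λ (i , j) (i<j , pij) → n≮0 (Equivalence.to (e i<j) pij)
pairs-clique (suc a) b P? e = trans (pairs-suc P?) (trans (cong₂ _+_
  (trans (count-cong _ _ (All.universal
    (λ j → mk⇔ (s≤s⁻¹ ∘ Equivalence.to (e (s≤s z≤n))) (Equivalence.from (e (s≤s z≤n)) ∘ s≤s)) (allFin (a + b)))) (count-below a b))
  (pairs-clique a b (λ i j → P? (suc i) (suc j))
    λ i<j → mk⇔ (s≤s⁻¹ ∘ Equivalence.to (e (s≤s i<j))) (Equivalence.from (e (s≤s i<j)) ∘ s≤s)))
  (sym (suc-C-2 a)))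

-- Induction on the left part: each deleted vertex `zero` is joined to the `b` vertices on the
-- right.
pairs-bipartite : ∀ a b {P : B.Rel (Fin (a + b)) p} (P? : B.Decidable P) →
  (∀ {i j} → i Fin.< j → P i j ⇔ (toℕ i < a × a ≤ toℕ j)) → pairs P? ≡ a * b
pairs-bipartite zero b P? e = count-none _ (cartesianProduct (allFin b) (allFin b))
  λ (i , j) (i<j , pij) → n≮0 (proj₁ (Equivalence.to (e i<j) pij))
pairs-bipartite (suc a) b P? e = trans (pairs-suc P?) (cong₂ _+_
  (trans (count-cong _ _ (All.universal
    (λ j → mk⇔ (s≤s⁻¹ ∘ proj₂ ∘ Equivalence.to (e (s≤s z≤n))) (λ a≤j → Equivalence.from (e (s≤s z≤n)) (s≤s z≤n , s≤s a≤j)))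
    (allFin (a + b)))) (count-above a b))
  (pairs-bipartite a b (λ i j → P? (suc i) (suc j))
    λ i<j → mk⇔ (λ pij → let (i<a , a≤j) = Equivalence.to (e (s≤s i<j)) pij in s≤s⁻¹ i<a , s≤s⁻¹ a≤j)
                (λ (i<a , a≤j) → Equivalence.from (e (s≤s i<j)) (s≤s i<a , s≤s a≤j))))

pairs-all : ∀ n → pairs {n = n} (λ _ _ → yes tt) ≡ n C 2
pairs-all n = subst (λ k → pairs {n = k} (λ _ _ → yes tt) ≡ n C 2) (+-identityʳ n)
  (pairs-clique n 0 (λ _ _ → yes tt) λ {_} {j} _ → mk⇔ (λ _ → subst (toℕ j <_) (+-identityʳ n) (toℕ<n j)) (λ _ → tt))

pairs-complement : ∀ {n} {P : B.Rel (Fin n) p} (P? : B.Decidable P) →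
  pairs P? + pairs (λ i j → ¬? (P? i j)) ≡ n C 2
pairs-complement {n = n} P? =
  trans (count-× (λ (i , j) → i Fin.<? j) (λ (i , j) → P? i j) (cartesianProduct (allFin n) (allFin n)))
    (trans (count-cong _ _ (All.universal (λ _ → mk⇔ (_, tt) proj₁) (cartesianProduct (allFin n) (allFin n)))) (pairs-all n))

module _ {n : ℕ} {P : B.Rel (Fin n) 0ℓ} (P? : B.Decidable P) (P-sym : B.Symmetric P) where

  splitting-R : e (R (splitting P P? P-sym)) ≡ pairs P?
  splitting-R = pairs-cong (adj? (R (splitting P P? P-sym))) P? λ i<j → mk⇔ proj₂ ((λ { refl → <-irrefl refl i<j }) ,_)

  splitting-B : e (B (splitting P P? P-sym)) ≡ pairs (λ i j → ¬? (P? i j))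
  splitting-B = pairs-cong (adj? (B (splitting P P? P-sym))) (λ i j → ¬? (P? i j)) λ i<j → mk⇔ proj₂ ((λ { refl → <-irrefl refl i<j }) ,_)

  -- The complement has equally many pairs. Such a coloring sits exactly at the threshold, so it
  -- meets the strict inequality in `Forces` for every `s` below `⌊ n C 2 /2⌋`.
  half-splitting : 2 * pairs P? ≡ n C 2 →
    ⌊ n C 2 /2⌋ ≡ e (R (splitting P P? P-sym)) ⊓ e (B (splitting P P? P-sym))
  half-splitting half = begin
    ⌊ n C 2 /2⌋                                 ≡⟨ cong ⌊_/2⌋ half ⟨
    ⌊ 2 * pairs P? /2⌋                          ≡⟨ cong (λ k → ⌊ pairs P? + k /2⌋) (+-identityʳ (pairs P?)) ⟩
    ⌊ pairs P? + pairs P? /2⌋                   ≡⟨ n≡⌊n+n/2⌋ (pairs P?) ⟨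
    pairs P?                                    ≡⟨ ⊓-idem (pairs P?) ⟨
    pairs P? ⊓ pairs P?                         ≡⟨ cong₂ _⊓_ splitting-R (trans splitting-B complement) ⟨
    e (R (splitting P P? P-sym)) ⊓ e (B (splitting P P? P-sym)) ∎
    where
    open ≡-Reasoning
    complement : pairs (λ i j → ¬? (P? i j)) ≡ pairs P?
    complement = +-cancelˡ-≡ (pairs P?) _ _
      (trans (pairs-complement P?) (trans (sym half) (cong (pairs P? +_) (+-identityʳ (pairs P?)))))

-- Arithmetic of halving the edges of a complete graph

choose-2 : ∀ n → 2 * (n C 2) + n ≡ n * n
choose-2 zero = refl
choose-2 (suc n) = begin
  2 * (suc n C 2) + suc n           ≡⟨ cong (λ k → 2 * k + suc n) (suc-C-2 n) ⟩
  2 * (n + n C 2) + suc n           ≡⟨ eq₁ n (n C 2) ⟩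
  (2 * (n C 2) + n) + (n + suc n)   ≡⟨ cong (_+ (n + suc n)) (choose-2 n) ⟩
  n * n + (n + suc n)               ≡⟨ eq₂ n ⟩
  suc n * suc n                     ∎
  where
  open ≡-Reasoning
  eq₁ : ∀ n k → 2 * (n + k) + suc n ≡ (2 * k + n) + (n + suc n)
  eq₁ = solve-∀
  eq₂ : ∀ n → n * n + (n + suc n) ≡ suc n * suc n
  eq₂ = solve-∀

-- Supplies the density `n * n / 8` for Kővári-Sós-Turán. Rounding gives `n C 2 ≤ 1 + (k + k)`, and
-- the lower-order terms `4 + 2 * n` are at most `n * n` once `4 ≤ n`.
half-dense : ∀ {n} → 4 ≤ n → ∀ k → ⌊ n C 2 /2⌋ ≤ k → n * n ≤ 8 * k
half-dense {n} 4≤n k ≤k = +-cancelʳ-≤ (n * n) _ _ (begin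
  n * n + n * n                    ≡⟨ cong₂ _+_ (choose-2 n) (choose-2 n) ⟨
  (2 * x + n) + (2 * x + n)        ≡⟨ eq₁ x n ⟩
  4 * x + 2 * n                    ≤⟨ +-monoˡ-≤ (2 * n) (*-monoʳ-≤ 4 x≤) ⟩
  4 * (1 + (k + k)) + 2 * n        ≡⟨ eq₂ k n ⟩
  8 * k + (4 + 2 * n)              ≤⟨ +-monoʳ-≤ (8 * k) (+-monoˡ-≤ (2 * n) (≤-trans 4≤n (m≤m+n n _))) ⟩
  8 * k + (2 * n + 2 * n)          ≡⟨ eq₃ k n ⟩
  8 * k + 4 * n                    ≤⟨ +-monoʳ-≤ (8 * k) (*-monoˡ-≤ n 4≤n) ⟩
  8 * k + n * n                    ∎)
  where
  open ≤-Reasoning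
  x = n C 2
  eq₁ : ∀ x n → (2 * x + n) + (2 * x + n) ≡ 4 * x + 2 * n
  eq₁ = solve-∀
  eq₂ : ∀ k n → 4 * (1 + (k + k)) + 2 * n ≡ 8 * k + (4 + 2 * n)
  eq₂ = solve-∀
  eq₃ : ∀ k n → 8 * k + (2 * n + 2 * n) ≡ 8 * k + 4 * n
  eq₃ = solve-∀
  ⌈/2⌉≤ : ∀ y → ⌈ y /2⌉ ≤ suc ⌊ y /2⌋
  ⌈/2⌉≤ zero = z≤n
  ⌈/2⌉≤ (suc zero) = s≤s z≤n
  ⌈/2⌉≤ (suc (suc y)) = s≤s (⌈/2⌉≤ y)
  x≤ : x ≤ 1 + (k + k)
  x≤ = ≤-trans (≤-reflexive (sym (⌊n/2⌋+⌈n/2⌉≡n x)))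
    (≤-trans (+-mono-≤ ≤k (≤-trans (⌈/2⌉≤ x) (s≤s ≤k))) (≤-reflexive (+-suc k k)))

half-positive : ∀ {n} → 4 ≤ n → 0 < ⌊ n C 2 /2⌋
half-positive {n} 4≤n with ⌊ n C 2 /2⌋ in eq
... | suc _ = s≤s z≤n
... | zero = contradiction (half-dense 4≤n 0 (≤-reflexive eq)) (<⇒≱ (*-mono-< (≤-trans (s≤s z≤n) 4≤n) (≤-trans (s≤s z≤n) 4≤n)))

-- a + b = N², the case in which (b − a)² = a + b.
half-bipartite : ∀ N → ∃[ a ] ∃[ b ] (N ≤ a + b × 2 * (a * b) ≡ (a + b) C 2)
-- The parts are the consecutive triangular numbers `N C 2` and `suc N C 2`, which differ by `N`.
half-bipartite N = T , T + N , ≤-trans (m≤n+m N T) (m≤n+m (T + N) T) ,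
  *-cancelˡ-≡ _ _ 2 (+-cancelʳ-≡ (T + (T + N)) _ _ (begin
    2 * (2 * (T * (T + N))) + (T + (T + N))         ≡⟨ eq₁ T N ⟩
    2 * (2 * (T * (T + N))) + (2 * T + N)           ≡⟨ cong (2 * (2 * (T * (T + N))) +_) (choose-2 N) ⟩
    2 * (2 * (T * (T + N))) + N * N                 ≡⟨ eq₂ T N ⟩
    (T + (T + N)) * (T + (T + N))                   ≡⟨ choose-2 (T + (T + N)) ⟨
    2 * ((T + (T + N)) C 2) + (T + (T + N))         ∎))
  where
  open ≡-Reasoning
  T = N C 2
  eq₁ : ∀ t n → 2 * (2 * (t * (t + n))) + (t + (t + n)) ≡ 2 * (2 * (t * (t + n))) + (2 * t + n)
  eq₁ = solve-∀
  eq₂ : ∀ t n → 2 * (2 * (t * (t + n))) + n * n ≡ (t + (t + n)) * (t + (t + n))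
  eq₂ = solve-∀

-- With x = 2(a + d) + 1 and y = 2a + 1 the equation reads x² − 2y² = −1, and the
-- recursion is multiplication of x + y√2 by 3 + 2√2.
pell : ∀ N → ∃[ a ] ∃[ d ] (N ≤ a × d * d + d + 2 * (a * d) ≡ a * a + a)
-- This is the solution `x = y = 1`.
pell zero = 0 , 0 , z≤n , refl
pell (suc N) with pell N
... | a , d , N≤a , eq = 2 + 5 * a + 2 * d , 1 + 2 * a + d
  , s≤s (≤-trans (m≤n⇒m≤1+n N≤a) (s≤s (≤-trans (m≤m+n a (4 * a)) (m≤m+n (5 * a) (2 * d)))))
  -- The recursion preserves the difference of the two sides; `step` states this without
  -- subtraction, with the old sides exchanged.
  , +-cancelʳ-≡ (a * a + a) _ _ (trans (step a d) (cong (a′ * a′ + a′ +_) eq))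
  where
  a′ : ℕ
  a′ = 2 + 5 * a + 2 * d
  step : ∀ a d → let a′ = 2 + 5 * a + 2 * d; d′ = 1 + 2 * a + d in
    d′ * d′ + d′ + 2 * (a′ * d′) + (a * a + a) ≡ a′ * a′ + a′ + (d * d + d + 2 * (a * d))
  step = solve-∀

-- For a clique on `suc a` of `suc (a + d)` vertices, clearing denominators leaves
-- `2 * (suc a * a) = suc (a + d) * (a + d)`, which simplifies to the equation of `pell`.
half-clique : ∀ N → ∃[ a ] ∃[ b ] (N ≤ a + b × 2 * (a C 2) ≡ (a + b) C 2)
half-clique N with pell N
... | a , d , N≤a , eq = suc a , d , m≤n⇒m≤1+n (≤-trans N≤a (m≤m+n a d)) ,
  *-cancelˡ-≡ _ _ 2 (+-cancelʳ-≡ (2 * suc a + suc (a + d)) _ _ (begin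
    2 * (2 * k) + (2 * suc a + suc (a + d))           ≡⟨ eq₁ k (suc a) (suc (a + d)) ⟩
    2 * (2 * k + suc a) + suc (a + d)                 ≡⟨ cong (λ x → 2 * x + suc (a + d)) (choose-2 (suc a)) ⟩
    2 * (suc a * suc a) + suc (a + d)                 ≡⟨ eq₂ a d ⟩
    (a * a + a) + rest                                ≡⟨ cong (_+ rest) eq ⟨
    (d * d + d + 2 * (a * d)) + rest                  ≡⟨ eq₃ a d ⟩
    suc (a + d) * suc (a + d) + 2 * suc a             ≡⟨ cong (_+ 2 * suc a) (choose-2 (suc (a + d))) ⟨
    2 * n + suc (a + d) + 2 * suc a                   ≡⟨ eq₄ n (suc a) (suc (a + d)) ⟩
    2 * n + (2 * suc a + suc (a + d))                 ∎))
  where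
  open ≡-Reasoning
  k = suc a C 2
  n = suc (a + d) C 2
  -- What must be added to either side of the Pell equation to reach the squares in `choose-2`.
  rest = a * a + 4 * a + d + 3
  eq₁ : ∀ k x y → 2 * (2 * k) + (2 * x + y) ≡ 2 * (2 * k + x) + y
  eq₁ = solve-∀
  eq₂ : ∀ a d → 2 * (suc a * suc a) + suc (a + d) ≡ (a * a + a) + (a * a + 4 * a + d + 3)
  eq₂ = solve-∀
  eq₃ : ∀ a d → (d * d + d + 2 * (a * d)) + (a * a + 4 * a + d + 3) ≡ suc (a + d) * suc (a + d) + 2 * suc a
  eq₃ = solve-∀
  eq₄ : ∀ n x y → 2 * n + y + 2 * x ≡ 2 * n + (2 * x + y)
  eq₄ = solve-∀

-- The equivalence

module _ {n : ℕ} (a : ℕ) where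

  -- The red pairs of the two extremal colorings: the clique on the first `a` vertices, and the
  -- complete bipartite graph between them and the rest.
  BothBelow Separated : B.Rel (Fin n) 0ℓ
  BothBelow i j = toℕ i < a × toℕ j < a
  Separated i j = (toℕ i < a × ¬ toℕ j < a) ⊎ (¬ toℕ i < a × toℕ j < a)

  bothBelow? : B.Decidable BothBelow
  bothBelow? i j = (toℕ i <? a) ×-dec (toℕ j <? a)

  separated? : B.Decidable Separated
  separated? i j = ((toℕ i <? a) ×-dec ¬? (toℕ j <? a)) ⊎-dec (¬? (toℕ i <? a) ×-dec (toℕ j <? a))

  separated-sym : B.Symmetric Separated
  separated-sym = Sum.swap ∘ Sum.map swap swap

bothBelow-half : ∀ N → ∃[ a ] ∃[ b ] (N ≤ a + b × 2 * pairs (bothBelow? {a + b} a) ≡ (a + b) C 2)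
bothBelow-half N =
  let a , b , N≤ , eq = half-clique N
  in a , b , N≤ , trans (cong (2 *_) (pairs-clique a b (bothBelow? a)
       λ i<j → mk⇔ proj₂ (λ j<a → <-trans i<j j<a , j<a))) eq

separated-half : ∀ N → ∃[ a ] ∃[ b ] (N ≤ a + b × 2 * pairs (separated? {a + b} a) ≡ (a + b) C 2)
separated-half N =
  let a , b , N≤ , eq = half-bipartite N
  in a , b , N≤ , trans (cong (2 *_) (pairs-bipartite a b (separated? a)
       λ i<j → mk⇔ (λ { (inj₁ (i<a , j≮a)) → i<a , ≮⇒≥ j≮a
                      ; (inj₂ (i≮a , j<a)) → contradiction (<-trans i<j j<a) i≮a })
                   (λ (i<a , a≤j) → inj₁ (i<a , ≤⇒≯ a≤j)))) eq

module _ {m : ℕ} {G : Graph m} where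

  -- Beyond the threshold of balanceability some `n` admits a coloring with exactly half of the
  -- pairs red, which exceeds bal in both colours. It therefore contains a balanced copy, whose red
  -- edges are the edges of `G` with images related by `P`.
  half-splitting⇒half : Balanceable G → {P : ∀ {n} → ℕ → B.Rel (Fin n) 0ℓ}
    (P? : ∀ {n} k → B.Decidable (P {n} k)) (P-sym : ∀ {n} k → B.Symmetric (P {n} k)) →
    (∀ N → ∃[ a ] ∃[ b ] (N ≤ a + b × 2 * pairs (P? {a + b} a) ≡ (a + b) C 2)) →
    ∃[ a ] ∃[ n ] Σ (Fin m ↣ Fin n) λ φ → let open Injection φ using (to) in
      IsHalf (e G) (count (λ (i , j) → P? a (to i) (to j)) (edges G))
  half-splitting⇒half (N , bal) {P} P? P-sym halves =
    let a , b , N≤ , half = halves N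
        s , (forces , _) , s< = bal (a + b) N≤
        c = splitting {a + b} (P a) (P? a) (P-sym a)
        φ , h = balanced⇒half G c (forces c (subst (s <_) (half-splitting {a + b} (P? a) (P-sym a) half) s<))
    in a , a + b , φ , subst (IsHalf (e G))
         (trans (countIn-copy G (R c) φ)
           (count-cong _ _ (All.map (λ i≢j → mk⇔ proj₂ ((i≢j ∘ Injection.injective φ) ,_)) (edges-distinct G)))) h

  module _ {n : ℕ} (a : ℕ) (φ : Fin m ↣ Fin n) where
    open Injection φ using (to)

    initial : Subset m
    initial = Vec.tabulate λ i → does (toℕ (to i) <? a)

    ∈-initial : ∀ {i} → i Subset.∈ initial ⇔ toℕ (to i) < a
    ∈-initial = ∈-tabulate (λ i → toℕ (to i) <? a)

    eInduced-initial : count (λ (i , j) → bothBelow? a (to i) (to j)) (edges G) ≡ eInduced G initial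
    eInduced-initial = count-cong _ _ (All.universal (λ _ → mk⇔
      (λ (i< , j<) → Equivalence.from ∈-initial i< , Equivalence.from ∈-initial j<)
      (λ (i∈ , j∈) → Equivalence.to ∈-initial i∈ , Equivalence.to ∈-initial j∈)) (edges G))

    ∈-final : ∀ {i} → i Subset.∈ ∁ initial ⇔ (¬ toℕ (to i) < a)
    ∈-final = mk⇔ (λ i∈ i< → x∈∁p⇒x∉p i∈ (Equivalence.from ∈-initial i<))
      (λ i≮ → x∉p⇒x∈∁p λ i∈ → i≮ (Equivalence.to ∈-initial i∈))

    eBetween-initial :
      count (λ (i , j) → separated? a (to i) (to j)) (edges G)
        ≡ eBetween G initial (∁ initial)
    eBetween-initial = count-cong _ _ (All.universal (λ _ → mk⇔
      (Sum.map (λ (i< , j≮) → Equivalence.from ∈-initial i< , Equivalence.from ∈-final j≮)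
               (λ (i≮ , j<) → Equivalence.from ∈-final i≮ , Equivalence.from ∈-initial j<))
      (Sum.map (λ (i∈ , j∈) → Equivalence.to ∈-initial i∈ , Equivalence.to ∈-final j∈)
               (λ (i∈ , j∈) → Equivalence.to ∈-final i∈ , Equivalence.to ∈-initial j∈))) (edges G))

  balanceable⇒induced : Balanceable G → ∃[ W ] IsHalf (e G) (eInduced G W)
  balanceable⇒induced bal =
    let a , _ , φ , h = half-splitting⇒half bal {BothBelow} bothBelow? (λ _ → swap) bothBelow-half
    in initial a φ , subst (IsHalf (e G)) (eInduced-initial a φ) h

  balanceable⇒partition : Balanceable G → ∃[ X ] ∃[ Y ] (IsPartition X Y × IsHalf (e G) (eBetween G X Y))
  balanceable⇒partition bal =
    let a , _ , φ , h = half-splitting⇒half bal {Separated} separated? separated-sym separated-half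
    in initial a φ , ∁ (initial a φ) , (p∪∁p≡⊤ (initial a φ) , ∩-inverseʳ (initial a φ))
       , subst (IsHalf (e G)) (eBetween-initial a φ) h

  partition×induced⇒balanceable :
    (∃[ X ] ∃[ Y ] (IsPartition X Y × IsHalf (e G) (eBetween G X Y))) →
    (∃[ W ] IsHalf (e G) (eInduced G W)) → Balanceable G
  partition×induced⇒balanceable partition induced = N , bal
    where
    -- `s` is the sum of the two clique sizes needed to combine a red and a blue clique, `K` is the
    -- diagonal Ramsey bound for `s`, and `N` adds up the two Kővári-Sós-Turán bounds for `K` and
    -- the 4 of `half-dense`.
    s = m + m + suc (2 ^ (m + m) * m)
    K = 2 ^ (s + s)
    N = 4 + (16 * (32 * K) + 32 * (2 ^ (32 * K) * K))

    module _ (n : ℕ) (N≤n : N ≤ n) where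
      4≤n : 4 ≤ n
      4≤n = ≤-trans (m≤m+n 4 (16 * (32 * K) + 32 * (2 ^ (32 * K) * K))) N≤n

      suc-pred-half : suc (pred ⌊ n C 2 /2⌋) ≡ ⌊ n C 2 /2⌋
      suc-pred-half = suc-pred ⌊ n C 2 /2⌋ {{>-nonZero (half-positive 4≤n)}}

      -- Exceeding the predecessor means having at least `⌊ n C 2 /2⌋` edges in each colour; this is
      -- the largest bound that balanceability permits.
      forces : Forces n G (pred ⌊ n C 2 /2⌋)
      forces c s< = pattern⇒balanced G c
        (dense⇒pattern c m s K (m≤m+n (m + m) (suc (2 ^ (m + m) * m))) (m≤n+m (suc (2 ^ (m + m) * m)) (m + m)) ≤-refl
          (≤-trans (≤-trans (m≤m+n (16 * (32 * K)) (32 * (2 ^ (32 * K) * K))) (m≤n+m _ 4)) N≤n)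
          (≤-trans (≤-trans (m≤n+m (32 * (2 ^ (32 * K) * K)) (16 * (32 * K))) (m≤n+m _ 4)) N≤n)
          (half-dense 4≤n _ (m≤n⊓o⇒m≤n _ _ half≤)) (half-dense 4≤n _ (m≤n⊓o⇒m≤o _ _ half≤)))
        partition induced
        where
        half≤ : ⌊ n C 2 /2⌋ ≤ e (R c) ⊓ e (B c)
        half≤ = subst (_≤ e (R c) ⊓ e (B c)) suc-pred-half s<

      bal : ∃[ s ] (IsBal n G s × s < ⌊ n C 2 /2⌋)
      -- The least forcing bound is at most the one just found, hence below `⌊ n C 2 /2⌋`.
      bal = let s , forced , s≤ , minimal = least (forces? n G) _ forces
            in s , (forced , minimal) , ≤-<-trans s≤ (≤-reflexive suc-pred-half)

corollary2p5 : (m : ℕ) (G : Graph m) →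
    Balanceable G ⇔
    ((∃[ X ] ∃[ Y ] (IsPartition X Y × IsHalf (e G) (eBetween G X Y))) ×
    (∃[ W ] IsHalf (e G) (eInduced G W)))
corollary2p5 m G = mk⇔ (λ bal → balanceable⇒partition {G = G} bal , balanceable⇒induced {G = G} bal)
  (λ (partition , induced) → partition×induced⇒balanceable {G = G} partition induced)
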